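{- Let $R$ be a commutative associative ring with unit element, let $a,b\in R$, and let $m\ge 1$ be an integer. Let $T_{a,b}$ be the symmetric $2m\times 2m$ matrix over $R$ whose diagonal entries are $0$, whose entries in positions $(i,i+1)$ and $(i+1,i)$ ($1\le i\le 2m-1$) are equal to $a$, and all of whose other entries are equal to $b$. Then, with the convention $0^0=1$, $$\mathrm{Hf}(T_{a,b})=\sum_{k=0}^{m}(a-b)^{m-k}\,b^{k}\,\frac{(m+k)!}{k!\,(m-k)!\,2^{k}}.$$ (Here each coefficient $\frac{(m+k)!}{k!(m-k)!2^k}$ is a positive integer, acting on $R$ by repeated addition.)
   Context: For a symmetric matrix $A=(a_{ij})$ of order $n=2m$ over a commutative ring, the hafnian is $\mathrm{Hf}(A)=\sum a_{i_1i_2}a_{i_3i_4}\cdots a_{i_{n-1}i_n}$, where the sum runs over all partitions of $\{1,\dots,n\}$ into $m$ disjoint unordered pairs $\{i_1,i_2\},\dots,\{i_{n-1},i_n\}$ (each partition counted once, irrespective of the order of the pairs and of the elements within each pair). Diagonal entries do not enter the definition. The hafnian of the empty ($0\times 0$) matrix is $1$. -}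

module Defs where

open import Algebra.Bundles using (CommutativeRing)
open import Data.Bool.Base using (if_then_else_)
open import Data.Fin.Base using (Fin; toℕ)
open import Data.Fin.Properties using (_≟_; _<?_; all?)
open import Data.List.Base using (List; []; _∷_; [_]; _++_; map; foldr; filter; allFin; cartesianProduct)
open import Data.List.Relation.Unary.AllPairs using (AllPairs; allPairs?)
open import Data.List.Relation.Unary.Any using (Any; any?)
open import Data.Nat.Base as ℕ using (ℕ; suc; NonZero; _!)
open import Data.Nat.DivMod using (_/_)
open import Data.Nat.Properties as ℕ using (m*n≢0; m^n≢0; _!*_!≢0)
open import Data.Product.Base using (_×_; _,_)
open import Data.Sum.Base using (_⊎_)
open import Relation.Binary.PropositionalEquality.Core using (_≡_)
open import Relation.Nullary.Decidable using (Dec; does; ¬?; _×-dec_; _⊎-dec_)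
open import Relation.Nullary.Negation using (¬_)

-- The unordered pair {i , j} is represented by (i , j) with i < j.
Pair : ℕ → Set
Pair n = Fin n × Fin n

pairs : ∀ n → List (Pair n)
pairs n = filter (λ (i , j) → i <? j) (cartesianProduct (allFin n) (allFin n))

infix 4 _∈ₚ_ _∈ₚ?_

_∈ₚ_ : ∀ {n} → Fin n → Pair n → Set
v ∈ₚ (i , j) = v ≡ i ⊎ v ≡ j

_∈ₚ?_ : ∀ {n} (v : Fin n) (p : Pair n) → Dec (v ∈ₚ p)
v ∈ₚ? (i , j) = (v ≟ i) ⊎-dec (v ≟ j)

Disjoint : ∀ {n} → Pair n → Pair n → Set
Disjoint p q = ∀ v → ¬ (v ∈ₚ p × v ∈ₚ q)

disjoint? : ∀ {n} (p q : Pair n) → Dec (Disjoint p q)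
disjoint? p q = all? λ v → ¬? ((v ∈ₚ? p) ×-dec (v ∈ₚ? q))

IsPartition : ∀ {n} → List (Pair n) → Set
IsPartition ps = AllPairs Disjoint ps × (∀ v → Any (v ∈ₚ_) ps)

isPartition? : ∀ {n} (ps : List (Pair n)) → Dec (IsPartition ps)
isPartition? ps = allPairs? disjoint? ps ×-dec all? λ v → any? (v ∈ₚ?_) ps

sublists : ∀ {A : Set} → List A → List (List A)
sublists []       = [ [] ]
sublists (x ∷ xs) = map (x ∷_) (sublists xs) ++ sublists xs

-- As `pairs n` has no repetitions, its sublists are exactly the sets of
-- unordered pairs, each occurring once; hence so does every partition.
partitions : ∀ n → List (List (Pair n))
partitions n = filter isPartition? (sublists (pairs n))

denominator : ℕ → ℕ → ℕ
denominator m k = k ! ℕ.* (m ℕ.∸ k) ! ℕ.* 2 ℕ.^ k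

denominator≢0 : ∀ m k → NonZero (denominator m k)
denominator≢0 m k = m*n≢0 _ _ {{k !* (m ℕ.∸ k) !≢0}} {{m^n≢0 2 k}}

-- _/_ is floor division.
coefficient : ℕ → ℕ → ℕ
coefficient m k = (m ℕ.+ k) ! / denominator m k
  where instance _ = denominator≢0 m k

module Hafnian {c ℓ} (R : CommutativeRing c ℓ) where

  open CommutativeRing R
  open import Algebra.Properties.Semiring.Exp semiring public using (_^_)
  open import Algebra.Properties.Semiring.Mult semiring public
    using () renaming (_×_ to _·_)
  open import Algebra.Properties.Semiring.Sum semiring public
    using (sum; sum⁺-syntax)

  Matrix : ℕ → Set c
  Matrix n = Fin n → Fin n → Carrier

  weight : ∀ {n} → Matrix n → List (Pair n) → Carrier
  weight A = foldr (λ (i , j) x → A i j * x) 1#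

  -- Intended for symmetric A of even order. Only the entries A i j with
  -- i < j are read, which for symmetric A is no restriction.
  hafnian : ∀ {n} → Matrix n → Carrier
  hafnian {n} A = foldr (λ ps x → weight A ps + x) 0# (partitions n)

  T : Carrier → Carrier → ∀ {n} → Matrix n
  T a b i j =
    if does (i ≟ j) then 0#
    else if does ((toℕ j ℕ.≟ suc (toℕ i)) ⊎-dec (toℕ i ℕ.≟ suc (toℕ j))) then a
    else b

{-# OPTIONS --safe #-}

-- Write a = b + c. Expanding every product over the consecutive pairs marked c
-- turns the hafnian into a sum over matchings M of the path 1 — 2 — ⋯ — 2m, of
-- c^|M| times the hafnian of the constant matrix b on the 2m ∸ 2|M| vertices
-- missed by M. The path has C(2m ∸ j , j) matchings with j edges, and 2k
-- vertices have (2k ∸ 1)!! perfect matchings; put j = m ∸ k.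
--
-- The expansion is justified by induction along row expansion of the hafnian:
-- deleting a vertex y from a set S and then choosing a matching of the path on
-- S ∖ y is choosing a matching of the path on S together with a vertex y that
-- it misses.

module Submission where

open import Algebra.Bundles using (CommutativeRing)
open import Data.Bool.Base using (Bool; true; false; _∧_; if_then_else_)
open import Data.Fin.Base using (Fin; zero; suc; toℕ; opposite; _<_)
open import Data.Fin.Permutation using (reverse)
open import Data.Fin.Properties using (_≟_; _<?_; all?; opposite-prop; toℕ≤pred[n])
open import Data.Fin.Subset using (Subset; inside; outside; _∈_; ⊤)
open import Data.Fin.Subset.Properties using (_∈?_; ∈⊤)
open import Data.List.Base using (List; []; _∷_; _++_; map; foldr; filter; allFin; tabulate; cartesianProduct)
open import Data.List.Membership.Propositional using (lose)
open import Data.List.Properties using (filter-++; filter-≐; filter-accept; filter-reject; map-++; map-tabulate)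
open import Data.List.Relation.Unary.All as All using (All; _∷_)
open import Data.List.Relation.Unary.AllPairs using (AllPairs; allPairs?; []; _∷_)
open import Data.List.Relation.Unary.Any using (Any; any?; here; there)
open import Data.Nat.Base as ℕ using (ℕ; zero; suc; pred; _∸_; _!; _≤_; _≥_; _>_)
open import Data.Nat.Combinatorics using (_C_; nCk≡n!/k![n-k]!; k![n∸k]!∣n!; k>n⇒nCk≡0; nCk+nC[k+1]≡[n+1]C[k+1])
open import Data.Nat.Divisibility using (_∣_; divides)
open import Data.Nat.DivMod using (m/n*n≡m; m*n/n≡m; /-congˡ)
open import Data.Nat.Properties as ℕ using (_≤?_)
open import Data.Nat.Tactic.RingSolver using (solve-∀)
open import Data.Product.Base using (_×_; _,_; proj₁; proj₂)
open import Data.Sum.Base using (inj₁; inj₂; [_,_]′)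
open import Data.Vec.Base using ([]; _∷_; lookup; _[_]≔_; here; there)
open import Data.Vec.Properties using ([]=⇒lookup; lookup⇒[]=; lookup∘update; lookup∘update′)
open import Function.Base using (_∘_)
open import Relation.Binary.PropositionalEquality as ≡ using (_≡_; _≢_)
open import Relation.Nullary.Decidable using (yes; no; does; _×-dec_; _→-dec_)
open import Relation.Nullary.Negation using (¬_; contradiction)
open import Relation.Unary using (Decidable; _≐_)
open import Defs

private variable
  n : ℕ

-- Arithmetic of the coefficients.

-- k !! is the product (2k ∸ 1)(2k ∸ 3)⋯1 of the first k odd numbers.
_!! : ℕ → ℕ
zero  !! = 1
suc k !! = suc (2 ℕ.* k) ℕ.* k !!

2*suc : ∀ k → 2 ℕ.* suc k ≡ suc (suc (2 ℕ.* k))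
2*suc = solve-∀

!!*!*2^≡! : ∀ k → k !! ℕ.* (k ! ℕ.* 2 ℕ.^ k) ≡ (2 ℕ.* k) !
!!*!*2^≡! zero    = ≡.refl
!!*!*2^≡! (suc k) = begin
  suc (2 ℕ.* k) ℕ.* k !! ℕ.* (suc k ℕ.* k ! ℕ.* (2 ℕ.* 2 ℕ.^ k))  ≡⟨ arrange (k !!) (k !) (2 ℕ.^ k) k ⟩
  suc (suc (2 ℕ.* k)) ℕ.* (suc (2 ℕ.* k) ℕ.* (k !! ℕ.* (k ! ℕ.* 2 ℕ.^ k)))
    ≡⟨ ≡.cong (λ x → suc (suc (2 ℕ.* k)) ℕ.* (suc (2 ℕ.* k) ℕ.* x)) (!!*!*2^≡! k) ⟩
  suc (suc (2 ℕ.* k)) !                                           ≡⟨ ≡.cong _! (2*suc k) ⟨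
  (2 ℕ.* suc k) !                                                 ∎
  where
  open ≡.≡-Reasoning
  arrange : ∀ d f t k → suc (2 ℕ.* k) ℕ.* d ℕ.* (suc k ℕ.* f ℕ.* (2 ℕ.* t))
                      ≡ suc (suc (2 ℕ.* k)) ℕ.* (suc (2 ℕ.* k) ℕ.* (d ℕ.* (f ℕ.* t)))
  arrange = solve-∀

nCk*k!*[n∸k]!≡n! : ∀ {n k} → k ≤ n → (n C k) ℕ.* (k ! ℕ.* (n ∸ k) !) ≡ n !
nCk*k!*[n∸k]!≡n! {n} {k} k≤n = ≡.trans
  (≡.cong (ℕ._* (k ! ℕ.* (n ∸ k) !)) (nCk≡n!/k![n-k]! k≤n))
  (m/n*n≡m (k![n∸k]!∣n! k≤n))
  where instance _ = k ℕ.!* (n ∸ k) !≢0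

[m+k]∸[m∸k]≡2*k : ∀ {m k} → k ≤ m → m ℕ.+ k ∸ (m ∸ k) ≡ 2 ℕ.* k
[m+k]∸[m∸k]≡2*k {m} {k} k≤m = begin
  m ℕ.+ k ∸ (m ∸ k)                 ≡⟨ ≡.cong (λ x → x ℕ.+ k ∸ (m ∸ k)) (ℕ.m∸n+n≡m k≤m) ⟨
  m ∸ k ℕ.+ k ℕ.+ k ∸ (m ∸ k)       ≡⟨ ≡.cong (_∸ (m ∸ k)) (arrange (m ∸ k) k) ⟩
  2 ℕ.* k ℕ.+ (m ∸ k) ∸ (m ∸ k)     ≡⟨ ℕ.m+n∸n≡m (2 ℕ.* k) (m ∸ k) ⟩
  2 ℕ.* k                           ∎
  where
  open ≡.≡-Reasoning
  arrange : ∀ j k → j ℕ.+ k ℕ.+ k ≡ 2 ℕ.* k ℕ.+ j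
  arrange = solve-∀

2*m∸[m∸k]≡m+k : ∀ {m k} → k ≤ m → 2 ℕ.* m ∸ (m ∸ k) ≡ m ℕ.+ k
2*m∸[m∸k]≡m+k {m} {k} k≤m = begin
  2 ℕ.* m ∸ (m ∸ k)    ≡⟨ ≡.cong (λ x → m ℕ.+ x ∸ (m ∸ k)) (ℕ.+-identityʳ m) ⟩
  m ℕ.+ m ∸ (m ∸ k)    ≡⟨ ℕ.+-∸-assoc m (ℕ.m∸n≤m m k) ⟩
  m ℕ.+ (m ∸ (m ∸ k))  ≡⟨ ≡.cong (m ℕ.+_) (ℕ.m∸[m∸n]≡n k≤m) ⟩
  m ℕ.+ k              ∎
  where open ≡.≡-Reasoning

-- The binomial contributes `(m + k)! / ((m ∸ k)! (2k)!)` and `k !!` equals `(2k)! / (k! 2^k)`; the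
-- factor `(2k)!` cancels. Hence the floor division in `coefficient` is exact.
C*!!*denominator≡! : ∀ {m k} → k ≤ m → ((m ℕ.+ k) C (m ∸ k)) ℕ.* k !! ℕ.* denominator m k ≡ (m ℕ.+ k) !
C*!!*denominator≡! {m} {k} k≤m = begin
  c ℕ.* k !! ℕ.* (k ! ℕ.* (m ∸ k) ! ℕ.* 2 ℕ.^ k)   ≡⟨ arrange c (k !!) (k !) ((m ∸ k) !) (2 ℕ.^ k) ⟩
  c ℕ.* ((m ∸ k) ! ℕ.* (k !! ℕ.* (k ! ℕ.* 2 ℕ.^ k)))  ≡⟨ ≡.cong (λ x → c ℕ.* ((m ∸ k) ! ℕ.* x)) (!!*!*2^≡! k) ⟩
  c ℕ.* ((m ∸ k) ! ℕ.* (2 ℕ.* k) !)                ≡⟨ ≡.cong (λ x → c ℕ.* ((m ∸ k) ! ℕ.* x !)) ([m+k]∸[m∸k]≡2*k k≤m) ⟨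
  c ℕ.* ((m ∸ k) ! ℕ.* (m ℕ.+ k ∸ (m ∸ k)) !)      ≡⟨ nCk*k!*[n∸k]!≡n! (ℕ.≤-trans (ℕ.m∸n≤m m k) (ℕ.m≤m+n m k)) ⟩
  (m ℕ.+ k) !                                      ∎
  where
  open ≡.≡-Reasoning
  c = (m ℕ.+ k) C (m ∸ k)
  arrange : ∀ c d f g t → c ℕ.* d ℕ.* (f ℕ.* g ℕ.* t) ≡ c ℕ.* (g ℕ.* (d ℕ.* (f ℕ.* t)))
  arrange = solve-∀

coefficient≡C*!! : ∀ {m k} → k ≤ m → coefficient m k ≡ ((m ℕ.+ k) C (m ∸ k)) ℕ.* k !!
coefficient≡C*!! {m} {k} k≤m = ≡.trans
  (/-congˡ (≡.sym (C*!!*denominator≡! k≤m)))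
  (m*n/n≡m (((m ℕ.+ k) C (m ∸ k)) ℕ.* k !!) (denominator m k))
  where instance _ = denominator≢0 m k

denominator∣! : ∀ {m k} → k ≤ m → denominator m k ∣ (m ℕ.+ k) !
denominator∣! {m} {k} k≤m = divides (((m ℕ.+ k) C (m ∸ k)) ℕ.* k !!) (≡.sym (C*!!*denominator≡! k≤m))

coefficient>0 : ∀ {m k} → k ≤ m → coefficient m k > 0
coefficient>0 {m} {k} k≤m = ℕ.n≢0⇒n>0 λ coefficient≡0 →
  ℕ.≢-nonZero⁻¹ ((m ℕ.+ k) !) {{(m ℕ.+ k) ℕ.!≢0}} (≡.trans
    (≡.sym (C*!!*denominator≡! k≤m))
    (≡.cong (ℕ._* denominator m k) (≡.trans (≡.sym (coefficient≡C*!! k≤m)) coefficient≡0)))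

-- Pascal's rule with upper index `n ∸ i`. When `n < i` the subtractions truncate to 0, and all
-- three binomials vanish because their lower indices are positive.
[1+n∸i]C[1+i] : ∀ n i → (suc n ∸ i) C suc i ≡ ((n ∸ i) C i) ℕ.+ ((n ∸ i) C suc i)
[1+n∸i]C[1+i] n i with i ≤? n
... | yes i≤n = ≡.trans (≡.cong (_C suc i) (ℕ.+-∸-assoc 1 i≤n)) (≡.sym (nCk+nC[k+1]≡[n+1]C[k+1] (n ∸ i) i))
... | no  i≰n = let n<i = ℕ.≰⇒> i≰n in begin
  (suc n ∸ i) C suc i                         ≡⟨ ≡.cong (_C suc i) (ℕ.m≤n⇒m∸n≡0 n<i) ⟩
  0 C suc i                                   ≡⟨ k>n⇒nCk≡0 {0} {suc i} (ℕ.s≤s ℕ.z≤n) ⟩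
  0                                           ≡⟨ ≡.cong₂ ℕ._+_ (k>n⇒nCk≡0 {0} {i} (ℕ.≤-<-trans ℕ.z≤n n<i))
                                                                (k>n⇒nCk≡0 {0} {suc i} (ℕ.s≤s ℕ.z≤n)) ⟨
  (0 C i) ℕ.+ (0 C suc i)                     ≡⟨ ≡.cong (λ x → (x C i) ℕ.+ (x C suc i)) (ℕ.m≤n⇒m∸n≡0 (ℕ.<⇒≤ n<i)) ⟨
  ((n ∸ i) C i) ℕ.+ ((n ∸ i) C suc i)         ∎
  where open ≡.≡-Reasoning

-- The number of vertices missed by the matching does not change when the unmatched first vertex of
-- the path is moved to the `u` further vertices. The bound on `2i` keeps the subtraction from
-- truncating.
shift-index : ∀ {n i} u → 2 ℕ.* i ℕ.< n → suc u ℕ.+ (suc n ∸ 2 ℕ.* suc i) ≡ u ℕ.+ (n ∸ 2 ℕ.* i)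
shift-index {n} {i} u 2i<n = begin
  suc u ℕ.+ (suc n ∸ 2 ℕ.* suc i)   ≡⟨ ≡.cong (λ x → suc u ℕ.+ (suc n ∸ x)) (2*suc i) ⟩
  suc u ℕ.+ (n ∸ suc (2 ℕ.* i))     ≡⟨ ℕ.+-suc u _ ⟨
  u ℕ.+ suc (n ∸ suc (2 ℕ.* i))     ≡⟨ ≡.cong (u ℕ.+_) (ℕ.+-∸-assoc 1 2i<n) ⟨
  u ℕ.+ (n ∸ 2 ℕ.* i)               ∎
  where open ≡.≡-Reasoning

i<n∸i⇒2*i<n : ∀ {n i} → i ℕ.< n ∸ i → 2 ℕ.* i ℕ.< n
i<n∸i⇒2*i<n {n} {i} i<n∸i = ≡.subst (ℕ._< n) (≡.cong (i ℕ.+_) (≡.sym (ℕ.+-identityʳ i)))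
  (ℕ.m≤o∸n⇒m+n≤o (suc i) (ℕ.<⇒≤ (ℕ.m∸n≢0⇒n<m (ℕ.m<n⇒n≢0 i<n∸i))) i<n∸i)

-- Perfect matchings of a subset of the vertices.

-- The remaining vertices are not renumbered, so the remaining pairs keep their type.
erase : Subset n → Pair n → Subset n
erase S (i , j) = S [ i ]≔ outside [ j ]≔ outside

∈-[]≔outside⁺ : ∀ {S : Subset n} {i v} → v ∈ S → v ≢ i → v ∈ (S [ i ]≔ outside)
∈-[]≔outside⁺ {S = S} {v = v} v∈S v≢i =
  lookup⇒[]= v _ (≡.trans (lookup∘update′ v≢i S outside) ([]=⇒lookup v∈S))

∈-[]≔outside⁻ : ∀ {S : Subset n} {i v} → v ∈ (S [ i ]≔ outside) → v ∈ S × v ≢ i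
∈-[]≔outside⁻ {S = S} {i} {v} v∈ with v ≟ i
... | no v≢i = lookup⇒[]= v S (≡.trans (≡.sym (lookup∘update′ v≢i S outside)) ([]=⇒lookup v∈)) , v≢i
... | yes ≡.refl with () ← ≡.trans (≡.sym ([]=⇒lookup v∈)) (lookup∘update i S outside)

∈-erase⁺ : ∀ {S : Subset n} {p v} → v ∈ S → ¬ v ∈ₚ p → v ∈ erase S p
∈-erase⁺ v∈S v∉p = ∈-[]≔outside⁺ (∈-[]≔outside⁺ v∈S (v∉p ∘ inj₁)) (v∉p ∘ inj₂)

∈-erase⁻ : ∀ {S : Subset n} {p v} → v ∈ erase S p → v ∈ S × ¬ v ∈ₚ p
∈-erase⁻ v∈ with v∈′ , v≢j ← ∈-[]≔outside⁻ v∈ with v∈S , v≢i ← ∈-[]≔outside⁻ v∈′ =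
  v∈S , [ v≢i , v≢j ]′

-- Generalises `IsPartition` so that removing a pair stays within the notion. The pairs are drawn
-- from all of `Fin n`, so they must also be kept inside `S`: hence both implications.
IsPartitionOf : Subset n → List (Pair n) → Set
IsPartitionOf S ps =
  AllPairs Disjoint ps × (∀ v → (v ∈ S → Any (v ∈ₚ_) ps) × (Any (v ∈ₚ_) ps → v ∈ S))

isPartitionOf? : ∀ (S : Subset n) → Decidable (IsPartitionOf S)
isPartitionOf? S ps = allPairs? disjoint? ps ×-dec all? λ v →
  (v ∈? S →-dec any? (v ∈ₚ?_) ps) ×-dec (any? (v ∈ₚ?_) ps →-dec v ∈? S)

module _ {S : Subset n} {i j : Fin n} {ps : List (Pair n)} where

  private p = i , j

  -- Disjointness of `p` from each later pair says precisely that `ps` covers no vertex of `p`.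
  isPartitionOf-∷⁻ : IsPartitionOf S (p ∷ ps) → IsPartitionOf (erase S p) ps
  isPartitionOf-∷⁻ (p#ps ∷ ps# , S⇔) = ps# , λ v → to v , from v
    where
    to : ∀ v → v ∈ erase S p → Any (v ∈ₚ_) ps
    to v v∈ with v∈S , v∉p ← ∈-erase⁻ v∈ with proj₁ (S⇔ v) v∈S
    ... | here v∈p   = contradiction v∈p v∉p
    ... | there v∈ps = v∈ps
    from : ∀ v → Any (v ∈ₚ_) ps → v ∈ erase S p
    from v v∈ps = ∈-erase⁺ (proj₂ (S⇔ v) (there v∈ps))
      λ v∈p → All.lookupWith (λ { p#q v∈q → p#q v (v∈p , v∈q) }) p#ps v∈ps

  -- Vertices covered by `ps` lie in `erase S p`, hence off `p`; this gives back the disjointness.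
  isPartitionOf-∷⁺ : i ∈ S → j ∈ S → IsPartitionOf (erase S p) ps → IsPartitionOf S (p ∷ ps)
  isPartitionOf-∷⁺ i∈S j∈S (ps# , S⇔) = p#ps ∷ ps# , λ v → to v , from v
    where
    p#ps : All (Disjoint p) ps
    p#ps = All.tabulate λ q∈ps v (v∈p , v∈q) →
      proj₂ (∈-erase⁻ (proj₂ (S⇔ v) (lose q∈ps v∈q))) v∈p
    to : ∀ v → v ∈ S → Any (v ∈ₚ_) (p ∷ ps)
    to v v∈S with v ∈ₚ? p
    ... | yes v∈p = here v∈p
    ... | no  v∉p = there (proj₁ (S⇔ v) (∈-erase⁺ v∈S v∉p))
    from : ∀ v → Any (v ∈ₚ_) (p ∷ ps) → v ∈ S
    from v (here (inj₁ ≡.refl)) = i∈S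
    from v (here (inj₂ ≡.refl)) = j∈S
    from v (there v∈ps)         = proj₁ (∈-erase⁻ (proj₂ (S⇔ v) v∈ps))

isPartitionOf-∷-⊆ : ∀ {S : Subset n} {i j ps} → IsPartitionOf S ((i , j) ∷ ps) → i ∈ S × j ∈ S
isPartitionOf-∷-⊆ (_ , S⇔) = proj₂ (S⇔ _) (here (inj₁ ≡.refl)) , proj₂ (S⇔ _) (here (inj₂ ≡.refl))

isPartition≐isPartitionOf-⊤ : IsPartition {n} ≐ IsPartitionOf ⊤
isPartition≐isPartitionOf-⊤ =
  (λ (ps# , cover) → ps# , λ v → (λ _ → cover v) , (λ _ → ∈⊤)) ,
  (λ (ps# , cover) → ps# , λ v → proj₁ (cover v) ∈⊤)

isPartitionOf-[] : ∀ {s} {S : Subset n} → IsPartitionOf (s ∷ S) [] → s ≡ outside × IsPartitionOf S []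
isPartitionOf-[] {s = inside}  (_ , S⇔) with () ← proj₁ (S⇔ zero) here
isPartitionOf-[] {s = outside} (_ , S⇔) =
  ≡.refl , [] , λ v → (λ v∈S → contradiction (proj₁ (S⇔ (suc v)) (there v∈S)) λ ()) , λ ()

-- Splitting the list of pairs by its first row.

lift : Pair n → Pair (suc n)
lift (i , j) = suc i , suc j

-- An equality of lists, order included, because `partitionSum` recurses along the list: row `zero`
-- comes first, then the pairs on the other vertices.
pairs-suc : ∀ n → pairs (suc n) ≡ map (λ j → zero , suc j) (allFin n) ++ map lift (pairs n)
pairs-suc n = begin
  pairs (suc n)
    ≡⟨ ≡.cong (λ js → filter lt? (cartesianProduct (zero ∷ js) (zero ∷ js))) (map-tabulate {n = n} (λ i → i) suc) ⟨
  filter lt? (map (zero ,_) (map suc (allFin n)) ++ cartesianProduct (map suc (allFin n)) (zero ∷ map suc (allFin n)))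
    ≡⟨ filter-++ lt? (map (zero ,_) (map suc (allFin n))) _ ⟩
  filter lt? (map (zero ,_) (map suc (allFin n)))
    ++ filter lt? (cartesianProduct (map suc (allFin n)) (zero ∷ map suc (allFin n)))
    ≡⟨ ≡.cong₂ _++_ (row-zero (allFin n)) (rows-suc (allFin n) (allFin n)) ⟩
  map (λ j → zero , suc j) (allFin n) ++ map lift (pairs n) ∎
  where
  open ≡.≡-Reasoning
  lt? : ∀ {n} → Decidable {A = Pair n} (λ (i , j) → i < j)
  lt? (i , j) = i <? j

  row-zero : ∀ (js : List (Fin n)) → filter lt? (map (zero ,_) (map suc js)) ≡ map (λ j → zero , suc j) js
  row-zero []       = ≡.refl
  row-zero (j ∷ js) = ≡.cong (_ ∷_) (row-zero js)

  row-suc : ∀ i (js : List (Fin n)) →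
            filter lt? (map (suc i ,_) (map suc js)) ≡ map lift (filter lt? (map (i ,_) js))
  row-suc i []       = ≡.refl
  row-suc i (j ∷ js) with ih ← row-suc i js | does (i <? j)
  ... | true  = ≡.cong (_ ∷_) ih
  ... | false = ih

  rows-suc : ∀ (is js : List (Fin n)) →
             filter lt? (cartesianProduct (map suc is) (zero ∷ map suc js)) ≡ map lift (filter lt? (cartesianProduct is js))
  rows-suc []       js = ≡.refl
  rows-suc (i ∷ is) js = begin
    filter lt? (map (suc i ,_) (map suc js) ++ cartesianProduct (map suc is) (zero ∷ map suc js))
      ≡⟨ filter-++ lt? (map (suc i ,_) (map suc js)) _ ⟩
    filter lt? (map (suc i ,_) (map suc js)) ++ filter lt? (cartesianProduct (map suc is) (zero ∷ map suc js))
      ≡⟨ ≡.cong₂ _++_ (row-suc i js) (rows-suc is js) ⟩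
    map lift (filter lt? (map (i ,_) js)) ++ map lift (filter lt? (cartesianProduct is js))
      ≡⟨ map-++ lift (filter lt? (map (i ,_) js)) _ ⟨
    map lift (filter lt? (map (i ,_) js) ++ filter lt? (cartesianProduct is js))
      ≡⟨ ≡.cong (map lift) (filter-++ lt? (map (i ,_) js) _) ⟨
    map lift (filter lt? (map (i ,_) js ++ cartesianProduct is js)) ∎

-- The hafnian as a recursion over the list of pairs.

module Expansion {c ℓ} (R : CommutativeRing c ℓ) where

  open CommutativeRing R hiding (zero)
  open Hafnian R
  open import Algebra.Properties.Semiring.Sum semiring
    using (sum-syntax; sum-cong-≋)
  open import Relation.Binary.Reasoning.Setoid setoid

  when : Bool → Carrier → Carrier
  when s x = if s then x else 0#

  when-cong : ∀ s {x y} → x ≈ y → when s x ≈ when s y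
  when-cong true  x≈y = x≈y
  when-cong false x≈y = refl

  totalWeight : Matrix n → List (List (Pair n)) → Carrier
  totalWeight A = foldr (λ ps x → weight A ps + x) 0#

  module _ (A : Matrix n) where

    totalWeight-++ : ∀ xss yss → totalWeight A (xss ++ yss) ≈ totalWeight A xss + totalWeight A yss
    totalWeight-++ []         yss = sym (+-identityˡ _)
    totalWeight-++ (xs ∷ xss) yss = trans (+-congˡ (totalWeight-++ xss yss)) (sym (+-assoc _ _ _))

    module _ {P Q : List (Pair n) → Set} (P? : Decidable P) (Q? : Decidable Q) {p : Pair n} where

      totalWeight-map-∷ : (P ∘ (p ∷_)) ≐ Q → ∀ xss →
        totalWeight A (filter P? (map (p ∷_) xss)) ≈ A (proj₁ p) (proj₂ p) * totalWeight A (filter Q? xss)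
      totalWeight-map-∷ P≐Q []         = sym (zeroʳ _)
      totalWeight-map-∷ P≐Q (xs ∷ xss) with ih ← totalWeight-map-∷ P≐Q xss | P? (p ∷ xs) | Q? xs
      ... | yes _  | yes _  = trans (+-congˡ ih) (sym (distribˡ _ _ _))
      ... | no _   | no _   = ih
      ... | yes Px | no ¬Qx = contradiction (proj₁ P≐Q Px) ¬Qx
      ... | no ¬Px | yes Qx = contradiction (proj₂ P≐Q Qx) ¬Px

    totalWeight-none : ∀ {P : List (Pair n) → Set} (P? : Decidable P) {p} → (∀ {xs} → ¬ P (p ∷ xs)) → ∀ xss →
      totalWeight A (filter P? (map (p ∷_) xss)) ≈ 0#
    totalWeight-none P? ¬P []         = refl
    totalWeight-none P? {p} ¬P (xs ∷ xss) with P? (p ∷ xs)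
    ... | yes Px = contradiction Px ¬P
    ... | no _   = totalWeight-none P? ¬P xss

  -- The empty list of pairs partitions `S` only if `S` has no elements.
  emptyWeight : Subset n → Carrier
  emptyWeight []            = 1#
  emptyWeight (inside ∷ S)  = 0#
  emptyWeight (outside ∷ S) = emptyWeight S

  -- Each pair in turn is either taken, if both its ends are still uncovered, or skipped; `S`
  -- records the vertices yet to be covered.
  partitionSum : Matrix n → List (Pair n) → Subset n → Carrier
  partitionSum A []            S = emptyWeight S
  partitionSum A ((i , j) ∷ L) S =
    when (lookup S i ∧ lookup S j) (A i j * partitionSum A L (erase S (i , j))) + partitionSum A L S

  emptyWeight-correct : ∀ (A : Matrix n) S → totalWeight A (filter (isPartitionOf? S) ([] ∷ [])) ≈ emptyWeight S
  emptyWeight-correct A S with isPartitionOf? S []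
  ... | yes part = trans (reflexive (≡.cong (totalWeight A) (filter-accept (isPartitionOf? S) part)))
                         (trans (+-identityʳ 1#) (sym (lemma S part)))
    where
    lemma : ∀ {n} (S : Subset n) → IsPartitionOf S [] → emptyWeight S ≈ 1#
    lemma []      _    = refl
    lemma (s ∷ S) part with ≡.refl , part′ ← isPartitionOf-[] part = lemma S part′
  ... | no ¬part = trans (reflexive (≡.cong (totalWeight A) (filter-reject (isPartitionOf? S) ¬part)))
                         (sym (lemma S ¬part))
    where
    lemma : ∀ {n} (S : Subset n) → ¬ IsPartitionOf S [] → emptyWeight S ≈ 0#
    lemma []            ¬part = contradiction ([] , λ ()) ¬part
    lemma (inside ∷ S)  ¬part = refl
    lemma (outside ∷ S) ¬part = lemma S λ (_ , S⇔) → ¬part ([] , λ where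
      zero    → (λ ()) , λ ()
      (suc v) → (λ { (there v∈S) → contradiction (proj₁ (S⇔ v) v∈S) λ () }) , λ ())

  -- Sublists with and without `p` are separated. Those with `p` partition `S` exactly when their
  -- tails partition `erase S p`, provided both ends of `p` lie in `S`.
  partitionSum-correct : ∀ (A : Matrix n) L S →
    totalWeight A (filter (isPartitionOf? S) (sublists L)) ≈ partitionSum A L S
  partitionSum-correct A []                S = emptyWeight-correct A S
  partitionSum-correct A (p@(i , j) ∷ L) S = begin
    totalWeight A (filter (isPartitionOf? S) (map (p ∷_) (sublists L) ++ sublists L))
      ≡⟨ ≡.cong (totalWeight A) (filter-++ (isPartitionOf? S) (map (p ∷_) (sublists L)) _) ⟩
    totalWeight A (filter (isPartitionOf? S) (map (p ∷_) (sublists L)) ++ filter (isPartitionOf? S) (sublists L))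
      ≈⟨ totalWeight-++ A (filter (isPartitionOf? S) (map (p ∷_) (sublists L))) _ ⟩
    totalWeight A (filter (isPartitionOf? S) (map (p ∷_) (sublists L))) + totalWeight A (filter (isPartitionOf? S) (sublists L))
      ≈⟨ +-cong with-p (partitionSum-correct A L S) ⟩
    partitionSum A (p ∷ L) S ∎
    where
    with-p : totalWeight A (filter (isPartitionOf? S) (map (p ∷_) (sublists L)))
           ≈ when (lookup S i ∧ lookup S j) (A i j * partitionSum A L (erase S p))
    -- If an end of `p` is outside `S`, no partition of `S` contains `p`.
    with-p with lookup S i in Si | lookup S j in Sj
    ... | true  | true  = trans
      (totalWeight-map-∷ A (isPartitionOf? S) (isPartitionOf? (erase S p))
        (isPartitionOf-∷⁻ , isPartitionOf-∷⁺ (lookup⇒[]= i S Si) (lookup⇒[]= j S Sj)) (sublists L))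
      (*-congˡ (partitionSum-correct A L (erase S p)))
    ... | false | _     = totalWeight-none A (isPartitionOf? S)
      (λ part → contradiction (≡.trans (≡.sym ([]=⇒lookup (proj₁ (isPartitionOf-∷-⊆ part)))) Si) λ ()) (sublists L)
    ... | true  | false = totalWeight-none A (isPartitionOf? S)
      (λ part → contradiction (≡.trans (≡.sym ([]=⇒lookup (proj₂ (isPartitionOf-∷-⊆ part)))) Sj) λ ()) (sublists L)

  hafnian-partitionSum : ∀ (A : Matrix n) → hafnian A ≈ partitionSum A (pairs n) ⊤
  hafnian-partitionSum {n} A = trans
    (reflexive (≡.cong (totalWeight A)
      (filter-≐ isPartition? (isPartitionOf? ⊤) isPartition≐isPartitionOf-⊤ (sublists (pairs n)))))
    (partitionSum-correct A (pairs n) ⊤)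

  -- Row expansion along the first vertex.

  minor : Matrix (suc n) → Matrix n
  minor A i j = A (suc i) (suc j)

  partitionSum-lift-outside : ∀ (A : Matrix (suc n)) L S →
    partitionSum A (map lift L) (outside ∷ S) ≡ partitionSum (minor A) L S
  partitionSum-lift-outside A []            S = ≡.refl
  partitionSum-lift-outside A ((i , j) ∷ L) S = ≡.cong₂ (λ x y → when (lookup S i ∧ lookup S j) (_ * x) + y)
    (partitionSum-lift-outside A L (erase S (i , j))) (partitionSum-lift-outside A L S)

  -- No lifted pair contains `zero`, so that vertex can never be covered.
  partitionSum-lift-inside : ∀ (A : Matrix (suc n)) L S → partitionSum A (map lift L) (inside ∷ S) ≈ 0#
  partitionSum-lift-inside A []            S = refl
  partitionSum-lift-inside A ((i , j) ∷ L) S = trans (+-cong head (partitionSum-lift-inside A L S)) (+-identityˡ 0#)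
    where
    head : when (lookup S i ∧ lookup S j) (A (suc i) (suc j) * partitionSum A (map lift L) (inside ∷ erase S (i , j))) ≈ 0#
    head with lookup S i ∧ lookup S j
    ... | true  = trans (*-congˡ (partitionSum-lift-inside A L (erase S (i , j)))) (zeroʳ _)
    ... | false = refl

  module _ (A : Matrix (suc n)) (L : List (Pair (suc n))) where

    -- Once `zero` is covered, the guard of every pair in its row is `false`.
    partitionSum-row-outside : ∀ S js →
      partitionSum A (map (λ j → zero , suc j) js ++ L) (outside ∷ S) ≈ partitionSum A L (outside ∷ S)
    partitionSum-row-outside S []       = refl
    partitionSum-row-outside S (j ∷ js) = trans (+-identityˡ _) (partitionSum-row-outside S js)

    -- Stated for an arbitrary `f` because the induction passes from `f` to `f ∘ suc`. Taking a pair
    -- reduces the rest of the row to nothing; skipping it continues along the row.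
    partitionSum-row-inside : ∀ S {m} (f : Fin m → Fin n) →
      partitionSum A (map (λ j → zero , suc j) (tabulate f) ++ L) (inside ∷ S)
      ≈ sum (λ k → when (lookup S (f k)) (A zero (suc (f k)) * partitionSum A L (outside ∷ S [ f k ]≔ outside)))
        + partitionSum A L (inside ∷ S)
    partitionSum-row-inside S {zero}  f = sym (+-identityˡ _)
    partitionSum-row-inside S {suc m} f =
      trans (+-cong (when-cong (lookup S (f zero)) (*-congˡ rest-of-row)) (partitionSum-row-inside S (f ∘ suc)))
            (sym (+-assoc _ _ _))
      where rest-of-row = partitionSum-row-outside (S [ f zero ]≔ outside) (tabulate (f ∘ suc))

  module _ (A : Matrix (suc n)) (S : Subset n) where

    partitionSum-outside : partitionSum A (pairs (suc n)) (outside ∷ S) ≈ partitionSum (minor A) (pairs n) S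
    partitionSum-outside rewrite pairs-suc n = trans
      (partitionSum-row-outside A (map lift (pairs n)) S (allFin n))
      (reflexive (partitionSum-lift-outside A (pairs n) S))

    partitionSum-inside : partitionSum A (pairs (suc n)) (inside ∷ S)
      ≈ ∑[ j < n ] when (lookup S j) (A zero (suc j) * partitionSum (minor A) (pairs n) (S [ j ]≔ outside))
    partitionSum-inside rewrite pairs-suc n = begin
      partitionSum A (map (λ j → zero , suc j) (allFin n) ++ map lift (pairs n)) (inside ∷ S)
        ≈⟨ partitionSum-row-inside A (map lift (pairs n)) S (λ j → j) ⟩
      sum (λ j → when (lookup S j) (A zero (suc j) * partitionSum A (map lift (pairs n)) (outside ∷ S [ j ]≔ outside)))
        + partitionSum A (map lift (pairs n)) (inside ∷ S)
        ≈⟨ +-congˡ (partitionSum-lift-inside A (pairs n) S) ⟩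
      _ + 0#
        ≈⟨ +-identityʳ _ ⟩
      sum (λ j → when (lookup S j) (A zero (suc j) * partitionSum A (map lift (pairs n)) (outside ∷ S [ j ]≔ outside)))
        ≈⟨ sum-cong-≋ (λ j → when-cong (lookup S j) (*-congˡ (reflexive (partitionSum-lift-outside A (pairs n) _)))) ⟩
      sum (λ j → when (lookup S j) (A zero (suc j) * partitionSum (minor A) (pairs n) (S [ j ]≔ outside))) ∎

-- Matching sums of the path and their row expansions.

module Evaluation {c ℓ} (R : CommutativeRing c ℓ) where

  open CommutativeRing R hiding (zero)
  open Hafnian R
  open Expansion R
  open import Algebra.Properties.CommutativeMonoid.Mult +-commutativeMonoid
    using (×-distrib-+; ×-congʳ; ×-congˡ; ×-homo-+; ×-assocˡ)
  open import Algebra.Properties.Semiring.Mult semiring using (×-comm-*)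
  open import Algebra.Properties.Semiring.Sum semiring
    using (sum-syntax; sum-cong-≋; sum-replicate-zero; ∑-distrib-+; *-distribˡ-sum; sum-permute)
  open import Algebra.Solver.Ring.NaturalCoefficients.Default commutativeSemiring
    using (solve; _:+_; _:*_; _:=_; con)
  open import Relation.Binary.Reasoning.Setoid setoid

  ·-zeroʳ : ∀ n → n · 0# ≈ 0#
  ·-zeroʳ zero    = refl
  ·-zeroʳ (suc n) = trans (+-identityˡ _) (·-zeroʳ n)

  deletionSum : Subset n → (Subset n → Carrier) → Carrier
  deletionSum {n} S f = ∑[ j < n ] when (lookup S j) (f (S [ j ]≔ outside))

  sum-when-+ : ∀ (S : Subset n) (f g : Fin n → Carrier) →
    ∑[ j < n ] when (lookup S j) (f j + g j) ≈ ∑[ j < n ] when (lookup S j) (f j) + ∑[ j < n ] when (lookup S j) (g j)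
  sum-when-+ S f g = trans (sum-cong-≋ λ j → when-+ (lookup S j)) (∑-distrib-+ (λ j → when (lookup S j) (f j)) _)
    where
    when-+ : ∀ s {x y} → when s (x + y) ≈ when s x + when s y
    when-+ true  = refl
    when-+ false = sym (+-identityˡ 0#)

  sum-when-* : ∀ (S : Subset n) x (f : Fin n → Carrier) →
    ∑[ j < n ] when (lookup S j) (x * f j) ≈ x * ∑[ j < n ] when (lookup S j) (f j)
  sum-when-* S x f = trans (sum-cong-≋ λ j → when-* (lookup S j)) (sym (*-distribˡ-sum x λ j → when (lookup S j) (f j)))
    where
    when-* : ∀ s {y} → when s (x * y) ≈ x * when s y
    when-* true  = refl
    when-* false = sym (zeroʳ x)

  sum-when-0 : ∀ (S : Subset n) → ∑[ j < n ] when (lookup S j) 0# ≈ 0#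
  sum-when-0 {n} S = trans (sum-cong-≋ λ j → when-0 (lookup S j)) (sum-replicate-zero n)
    where
    when-0 : ∀ s → when s 0# ≈ 0#
    when-0 true  = refl
    when-0 false = refl

  module _ (b c : Carrier) where

    -- The hafnian of the u × u matrix with all entries b.
    complete : ℕ → Carrier
    complete zero          = 1#
    complete (suc zero)    = 0#
    complete (suc (suc u)) = suc u · (b * complete u)

    -- Puts the recursion in one form for all `u`; at `u = 0` both sides vanish.
    complete-suc : ∀ u → complete (suc u) ≈ b * (u · complete (pred u))
    complete-suc zero    = sym (zeroʳ b)
    complete-suc (suc u) = sym (×-comm-* (suc u) b (complete u))

    -- chain S u sums over the matchings of the path on S (only i, i + 1 are
    -- adjacent), each edge weighing c and the vertices missed, along with u
    -- further vertices, weighing as in complete. link S u is the part of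
    -- chain (inside ∷ S) u in which the first vertex is matched.
    chain link : Subset n → ℕ → Carrier
    chain []            u = complete u
    chain (outside ∷ S) u = chain S u
    chain (inside ∷ S)  u = chain S (suc u) + link S u
    link []            u = 0#
    link (outside ∷ S) u = 0#
    link (inside ∷ S)  u = c * chain S u

    -- Both are row expansions at one of the u + 1 further vertices: its partner
    -- is either a vertex of S or one of the other u. At u = 0 the value pred 0
    -- is immaterial.
    chain-suc : ∀ (S : Subset n) u →
      chain S (suc u) ≈ b * (deletionSum S (λ S′ → chain S′ u) + u · chain S (pred u))
    link-suc : ∀ (S : Subset n) u →
      link S (suc u) ≈ b * (deletionSum S (λ S′ → link S′ u) + u · link S (pred u))

    chain-suc []            u = trans (complete-suc u) (*-congˡ (sym (+-identityˡ _)))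
    chain-suc (outside ∷ S) u = trans (chain-suc S u) (*-congˡ (+-congʳ (sym (+-identityˡ _))))
    chain-suc (inside ∷ S)  u = begin
      chain S (suc (suc u)) + link S (suc u)
        ≈⟨ +-cong (chain-suc S (suc u)) (link-suc S u) ⟩
      -- Here `suc u · W` has unfolded to `W + u · W`. The single `W` is the case where the partner
      -- is the first vertex of `inside ∷ S`, which becomes the first summand of the new
      -- `deletionSum`.
      b * (X + (W + u · W)) + b * (Y + u · L)
        ≈⟨ solve 6 (λ b X Y W uW uL → b :* (X :+ (W :+ uW)) :+ b :* (Y :+ uL)
                                   := b :* ((W :+ (X :+ Y)) :+ (uW :+ uL))) refl b X Y W (u · W) (u · L) ⟩
      b * ((W + (X + Y)) + (u · W + u · L))
        ≈⟨ *-congˡ (+-cong (+-congˡ (sum-when-+ S _ _)) (trans (×-distrib-+ _ _ u) (+-congʳ (pred-· u)))) ⟨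
      b * ((W + deletionSum S (λ S′ → chain S′ (suc u) + link S′ u)) + u · (chain S (suc (pred u)) + L)) ∎
      where
      W = chain S u
      L = link S (pred u)
      X = deletionSum S λ S′ → chain S′ (suc u)
      Y = deletionSum S λ S′ → link S′ u
      -- `suc (pred u)` differs from `u` only at 0, where the multiplier is 0.
      pred-· : ∀ u → u · chain S (suc (pred u)) ≈ u · chain S u
      pred-· zero    = refl
      pred-· (suc u) = refl

    link-suc []            u = sym (trans (*-congˡ (trans (+-identityˡ _) (·-zeroʳ u))) (zeroʳ b))
    link-suc (outside ∷ S) u = sym (begin
      b * ((0# + deletionSum S (λ _ → 0#)) + u · 0#)
        ≈⟨ *-congˡ (+-cong (trans (+-identityˡ _) (sum-when-0 S)) (·-zeroʳ u)) ⟩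
      b * (0# + 0#)  ≈⟨ *-congˡ (+-identityˡ 0#) ⟩
      b * 0#         ≈⟨ zeroʳ b ⟩
      0#             ∎)
    link-suc (inside ∷ S)  u = begin
      c * chain S (suc u)
        ≈⟨ *-congˡ (chain-suc S u) ⟩
      c * (b * (X + u · W))
        ≈⟨ solve 4 (λ b c X uW → c :* (b :* (X :+ uW)) := b :* ((con 0 :+ c :* X) :+ c :* uW)) refl b c X (u · W) ⟩
      b * ((0# + c * X) + c * (u · W))
        ≈⟨ *-congˡ (+-cong (+-congˡ (sym (sum-when-* S c _))) (×-comm-* u c W)) ⟩
      b * ((0# + deletionSum S (λ S′ → c * chain S′ u)) + u · (c * W)) ∎
      where
      W = chain S (pred u)
      X = deletionSum S λ S′ → chain S′ u

    -- Equality and adjacency of indices survive a shift by one, so `minor` of `T a b` computes to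
    -- `T a b` again and the row expansion allows induction on the length of `S`.
    partitionSum-T : ∀ {a} → a ≈ b + c → (S : Subset n) → partitionSum (T a b) (pairs n) S ≈ chain S 0
    partitionSum-T a≈b+c []            = refl
    partitionSum-T {a = a} a≈b+c (outside ∷ S) = trans (partitionSum-outside (T a b) S) (partitionSum-T a≈b+c S)
    partitionSum-T {suc n} {a} a≈b+c (inside ∷ S) = begin
      partitionSum (T a b) (pairs (suc n)) (inside ∷ S)
        ≈⟨ partitionSum-inside (T a b) S ⟩
      ∑[ j < n ] when (lookup S j) (T a b {suc n} zero (suc j) * partitionSum (T a b) (pairs n) (S [ j ]≔ outside))
        ≈⟨ sum-cong-≋ (λ j → when-cong (lookup S j) (*-congˡ (partitionSum-T a≈b+c (S [ j ]≔ outside)))) ⟩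
      ∑[ j < n ] when (lookup S j) (T a b {suc n} zero (suc j) * chain (S [ j ]≔ outside) 0)
        ≈⟨ row S ⟩
      chain S 1 + link S 0 ∎
      where
      row : ∀ {n} (S : Subset n) →
        ∑[ j < n ] when (lookup S j) (T a b {suc n} zero (suc j) * chain (S [ j ]≔ outside) 0) ≈ chain S 1 + link S 0
      row []            = sym (+-identityʳ 0#)
      row (outside ∷ S) = begin
        0# + ∑[ j < _ ] when (lookup S j) (b * chain (S [ j ]≔ outside) 0)
          ≈⟨ +-cong refl (sum-when-* S b _) ⟩
        0# + b * X        ≈⟨ solve 2 (λ b X → con 0 :+ b :* X := b :* (X :+ con 0) :+ con 0) refl b X ⟩
        b * (X + 0#) + 0# ≈⟨ +-congʳ (chain-suc S 0) ⟨
        chain S 1 + 0#    ∎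
        where X = deletionSum S λ S′ → chain S′ 0
      row (inside ∷ S)  = begin
        a * W + ∑[ j < _ ] when (lookup S j) (b * chain (inside ∷ S [ j ]≔ outside) 0)
          ≈⟨ +-cong (*-congʳ a≈b+c) (sum-when-* S b _) ⟩
        -- Only the vertex next to the expanded one has entry `a`. Its share `b` completes the
        -- constant row, which `chain-suc` sums; its share `c` is the path edge counted by `link`.
        (b + c) * W + b * X
          ≈⟨ solve 4 (λ b c W X → (b :+ c) :* W :+ b :* X := b :* ((W :+ X) :+ con 0) :+ c :* W) refl b c W X ⟩
        b * ((W + X) + 0#) + c * W
          ≈⟨ +-congʳ (chain-suc (inside ∷ S) 0) ⟨
        chain (inside ∷ S) 1 + c * W ∎
        where
        W = chain S 0
        X = ∑[ j < _ ] when (lookup S j) (chain (inside ∷ S [ j ]≔ outside) 0)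

    -- Counting the matchings of the path.

    -- The contribution to chain ⊤ u of the matchings with j edges. For 2j > n
    -- the truncated subtractions are harmless, the binomial being 0.
    term : ℕ → ℕ → ℕ → Carrier
    term n u j = ((n ∸ j) C j) · (c ^ j * complete (u ℕ.+ (n ∸ 2 ℕ.* j)))

    private
      ·-absent : ∀ {n k} x → n ℕ.< k → (n C k) · x ≈ 0#
      ·-absent x n<k = ×-congˡ (k>n⇒nCk≡0 n<k)

    -- The first vertex is either missed, and joins the further vertices, or matched to the second,
    -- which leaves a path on `n` vertices and `i` edges to choose.
    term-suc : ∀ n u i → term (suc (suc n)) u (suc i) ≈ term (suc n) (suc u) (suc i) + c * term n u i
    term-suc n u i = begin
      ((suc n ∸ i) C suc i) · (c * c ^ i * complete (u ℕ.+ (suc (suc n) ∸ 2 ℕ.* suc i)))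
        ≈⟨ ×-congʳ ((suc n ∸ i) C suc i)
             (*-congˡ (reflexive (≡.cong (λ x → complete (u ℕ.+ (suc (suc n) ∸ x))) (2*suc i)))) ⟩
      ((suc n ∸ i) C suc i) · z
        ≈⟨ ×-congˡ ([1+n∸i]C[1+i] n i) ⟩
      (((n ∸ i) C i) ℕ.+ ((n ∸ i) C suc i)) · z
        ≈⟨ ×-homo-+ z ((n ∸ i) C i) ((n ∸ i) C suc i) ⟩
      ((n ∸ i) C i) · z + ((n ∸ i) C suc i) · z
        ≈⟨ +-comm _ _ ⟩
      ((n ∸ i) C suc i) · z + ((n ∸ i) C i) · z
        ≈⟨ +-cong shift (trans (×-congʳ ((n ∸ i) C i) (*-assoc c _ _)) (sym (×-comm-* ((n ∸ i) C i) c _))) ⟩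
      term (suc n) (suc u) (suc i) + c * term n u i ∎
      where
      z = c * c ^ i * complete (u ℕ.+ (n ∸ 2 ℕ.* i))
      shift : ((n ∸ i) C suc i) · z ≈ term (suc n) (suc u) (suc i)
      -- The two arguments of `complete` are shown equal only where the binomial is nonzero;
      -- elsewhere both sides vanish.
      shift with suc i ≤? n ∸ i
      ... | no  ≰ = trans (·-absent z (ℕ.≰⇒> ≰)) (sym (·-absent _ (ℕ.≰⇒> ≰)))
      ... | yes ≤ = ×-congʳ ((n ∸ i) C suc i) (*-congˡ
        (reflexive (≡.cong complete (≡.sym (shift-index {n} {i} u (i<n∸i⇒2*i<n {n} {i} ≤))))))

    term-zero : ∀ n u → term (suc n) u 0 ≈ term n (suc u) 0
    term-zero n u = ×-congʳ 1 (*-congˡ (reflexive (≡.cong complete (ℕ.+-suc u n))))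

    -- The range `N` is independent of `n`, as long as it includes every `j` with `2j ≤ n`. The
    -- induction can thus use range `suc N` for `suc n` vertices and `N` for `n`, so that the two
    -- sums align after splitting off `j = 0`.
    chain-⊤ : ∀ n u N → n ≤ suc (2 ℕ.* N) → chain (⊤ {n}) u ≈ ∑[ j ≤ N ] term n u (toℕ j)
    chain-⊤ 0 u N _ = sym (begin
      (1# * complete (u ℕ.+ 0) + 0#) + ∑[ j < N ] term 0 u (suc (toℕ j))
        ≈⟨ +-cong (trans (+-identityʳ _) (*-identityˡ _)) (trans (sum-cong-≋ {N} λ j →
             ·-absent {0} {suc (toℕ j)} (c ^ suc (toℕ j) * complete (u ℕ.+ 0)) ℕ.z<s) (sum-replicate-zero N)) ⟩
      complete (u ℕ.+ 0) + 0#
        ≈⟨ +-identityʳ _ ⟩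
      complete (u ℕ.+ 0)
        ≡⟨ ≡.cong complete (ℕ.+-identityʳ u) ⟩
      complete u ∎)
    chain-⊤ 1 u N _ = sym (begin
      (1# * complete (u ℕ.+ 1) + 0#) + ∑[ j < N ] term 1 u (suc (toℕ j))
        ≈⟨ +-cong (trans (+-identityʳ _) (*-identityˡ _)) (trans (sum-cong-≋ {N} λ j →
             ·-absent _ (ℕ.s≤s (ℕ.≤-trans (ℕ.≤-reflexive (ℕ.0∸n≡0 (toℕ j))) ℕ.z≤n))) (sum-replicate-zero N)) ⟩
      complete (u ℕ.+ 1) + 0#
        ≡⟨ ≡.cong (λ x → complete x + 0#) (ℕ.+-comm u 1) ⟩
      complete (suc u) + 0# ∎)
    chain-⊤ (suc (suc n)) u zero    (ℕ.s≤s ())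
    chain-⊤ (suc (suc n)) u (suc N) n≤ = begin
      chain (⊤ {suc n}) (suc u) + c * chain (⊤ {n}) u
        ≈⟨ +-cong (chain-⊤ (suc n) (suc u) (suc N) (ℕ.≤-trans (ℕ.n≤1+n _) n≤)) (*-congˡ (chain-⊤ n u N n≤′)) ⟩
      (term (suc n) (suc u) 0 + ∑[ i ≤ N ] term (suc n) (suc u) (suc (toℕ i))) + c * ∑[ i ≤ N ] term n u (toℕ i)
        ≈⟨ +-assoc _ _ _ ⟩
      term (suc n) (suc u) 0 + (∑[ i ≤ N ] term (suc n) (suc u) (suc (toℕ i)) + c * ∑[ i ≤ N ] term n u (toℕ i))
        ≈⟨ +-congˡ (+-congˡ (*-distribˡ-sum {suc N} c (λ i → term n u (toℕ i)))) ⟩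
      term (suc n) (suc u) 0 + (∑[ i ≤ N ] term (suc n) (suc u) (suc (toℕ i)) + ∑[ i ≤ N ] (c * term n u (toℕ i)))
        ≈⟨ +-congˡ (∑-distrib-+ {suc N} (λ i → term (suc n) (suc u) (suc (toℕ i))) (λ i → c * term n u (toℕ i))) ⟨
      term (suc n) (suc u) 0 + ∑[ i ≤ N ] (term (suc n) (suc u) (suc (toℕ i)) + c * term n u (toℕ i))
        ≈⟨ +-cong (term-zero (suc n) u) (sum-cong-≋ {suc N} λ i → term-suc n u (toℕ i)) ⟨
      term (suc (suc n)) u 0 + ∑[ i ≤ N ] term (suc (suc n)) u (suc (toℕ i)) ∎
      where
      n≤′ : n ≤ suc (2 ℕ.* N)
      n≤′ = ℕ.s≤s⁻¹ (ℕ.s≤s⁻¹ (≡.subst (suc (suc n) ≤_) (≡.cong suc (2*suc N)) n≤))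

    -- Even order and the closed formula.

    complete-even : ∀ k → complete (2 ℕ.* k) ≈ k !! · b ^ k
    complete-even zero    = sym (+-identityʳ 1#)
    complete-even (suc k) = begin
      complete (2 ℕ.* suc k)                    ≡⟨ ≡.cong complete (2*suc k) ⟩
      suc (2 ℕ.* k) · (b * complete (2 ℕ.* k))  ≈⟨ ×-congʳ (suc (2 ℕ.* k)) (*-congˡ (complete-even k)) ⟩
      suc (2 ℕ.* k) · (b * (k !! · b ^ k))      ≈⟨ ×-congʳ (suc (2 ℕ.* k)) (×-comm-* (k !!) b _) ⟩
      suc (2 ℕ.* k) · (k !! · (b * b ^ k))      ≈⟨ ×-assocˡ _ (suc (2 ℕ.* k)) (k !!) ⟩
      (suc k !!) · b ^ suc k                    ∎

    term-even : ∀ {m k} → k ≤ m → term (2 ℕ.* m) 0 (m ∸ k) ≈ coefficient m k · (c ^ (m ∸ k) * b ^ k)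
    term-even {m} {k} k≤m = begin
      ((2 ℕ.* m ∸ (m ∸ k)) C (m ∸ k)) · (c ^ (m ∸ k) * complete (2 ℕ.* m ∸ 2 ℕ.* (m ∸ k)))
        ≡⟨ ≡.cong₂ (λ x y → (x C (m ∸ k)) · (c ^ (m ∸ k) * complete y)) (2*m∸[m∸k]≡m+k k≤m)
             (≡.trans (≡.sym (ℕ.*-distribˡ-∸ 2 m (m ∸ k))) (≡.cong (2 ℕ.*_) (ℕ.m∸[m∸n]≡n k≤m))) ⟩
      M · (c ^ (m ∸ k) * complete (2 ℕ.* k))
        ≈⟨ ×-congʳ M (trans (*-congˡ (complete-even k)) (×-comm-* (k !!) _ _)) ⟩
      M · (k !! · (c ^ (m ∸ k) * b ^ k))
        ≈⟨ ×-assocˡ _ M (k !!) ⟩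
      (M ℕ.* k !!) · (c ^ (m ∸ k) * b ^ k)
        ≡⟨ ≡.cong (_· (c ^ (m ∸ k) * b ^ k)) (coefficient≡C*!! k≤m) ⟨
      coefficient m k · (c ^ (m ∸ k) * b ^ k) ∎
      where M = (m ℕ.+ k) C (m ∸ k)

    hafnian-T : ∀ {a} → a ≈ b + c → ∀ m →
      hafnian (T a b {2 ℕ.* m}) ≈ ∑[ k ≤ m ] (coefficient m (toℕ k) · (c ^ (m ∸ toℕ k) * b ^ toℕ k))
    hafnian-T {a} a≈b+c m = begin
      hafnian (T a b {2 ℕ.* m})                             ≈⟨ hafnian-partitionSum {2 ℕ.* m} (T a b) ⟩
      partitionSum (T a b) (pairs (2 ℕ.* m)) ⊤              ≈⟨ partitionSum-T a≈b+c (⊤ {2 ℕ.* m}) ⟩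
      -- The last rewriting reverses the summation, replacing the number `j` of edges by `m ∸ k`.
      chain (⊤ {2 ℕ.* m}) 0                                 ≈⟨ chain-⊤ (2 ℕ.* m) 0 m (ℕ.n≤1+n _) ⟩
      ∑[ j ≤ m ] term (2 ℕ.* m) 0 (toℕ j)                   ≈⟨ sum-permute {suc m} (term (2 ℕ.* m) 0 ∘ toℕ) reverse ⟩
      ∑[ k ≤ m ] term (2 ℕ.* m) 0 (toℕ (opposite k))        ≈⟨ sum-cong-≋ {suc m} (λ k → trans
          (reflexive (≡.cong (term (2 ℕ.* m) 0) (opposite-prop k))) (term-even (toℕ≤pred[n] k))) ⟩
      ∑[ k ≤ m ] (coefficient m (toℕ k) · (c ^ (m ∸ toℕ k) * b ^ toℕ k)) ∎

-- The first component certifies that each coefficient is an exact quotient and positive; the second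
-- is the expansion with `c = a - b`.
mainTheorem1 : ∀ {c ℓ} (R : CommutativeRing c ℓ) → let open CommutativeRing R in let open Hafnian R in
    (a b : Carrier) (m : ℕ) → m ≥ 1 →
    (∀ k → k ≤ m → denominator m k ∣ (m ℕ.+ k) ! × coefficient m k > 0)
    ×
    (hafnian (T a b {2 ℕ.* m}) ≈ ∑[ k ≤ m ] (coefficient m (toℕ k) · ((a - b) ^ (m ∸ toℕ k) * b ^ toℕ k)))
mainTheorem1 R a b m _ = (λ k k≤m → denominator∣! k≤m , coefficient>0 k≤m) , hafnian-T b (a - b) a≈b+[a-b] m
  where
  open CommutativeRing R
  open Evaluation R
  a≈b+[a-b] : a ≈ b + (a - b)
  a≈b+[a-b] = sym (trans (+-comm b _) (trans (+-assoc a _ b) (trans (+-congˡ (-‿inverseˡ b)) (+-identityʳ a))))
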